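{- Let $H\ge 1$ be an integer, $V$ a finite node set with root $r\in V$, and let $(x,l,g)\in\mathcal{P}$, where $\mathcal{P}$ is the polytope defined in the context. Let $v_1,v_2,\ldots,v_{H+1}$ be a directed walk with $H$ arcs (so $v_i\neq v_{i+1}$ for $1\le i\le H$; nodes may repeat otherwise) such that $v_1\neq r$. Then $$\sum_{i=1}^{H} x_{v_i,v_{i+1}}\le H-1.$$
   Context: Setting: $V$ is a finite set of nodes of a complete undirected graph, $r\in V$ is a root, and $H$ is the hop limit. For every ordered pair $(u,v)$ of distinct nodes of $V$ there is a real variable $x_{u,v}$ (arc variable), and for every $v\in V$ and $i\in\{0,\dots,H\}$ there are real variables $l_{v,i}$ ("position of $v$ is less than $i$") and $g_{i,v}$ ("position of $v$ is greater than $i$"). The partial-ordering polytope $\mathcal{P}$ is the set of all $(x,l,g)$ satisfying: (P1) $l_{r,0}=g_{0,r}=0$; (P2) $l_{v,1}=g_{H,v}=0$ for all $v\in V\setminus\{r\}$; (P3) $l_{v,i}-l_{v,i+1}\le 0$ for all $v\in V$, $i=0,\dots,H-1$; (P4) $g_{i,v}+l_{v,i+1}=1$ for all $v\in V$, $i=0,\dots,H-1$; (P5) $l_{u,i}+g_{i,v}\ge x_{u,v}$ for all $u\in V$, $v\in V\setminus\{u\}$, $i=0,\dots,H$; (P6) $\sum_{u\in V\setminus\{v\}}x_{u,v}\le 1$ for all $v\in V$; (P7) $\sum_{u\in V\setminus\{v,w\}}x_{u,v}\ge x_{v,w}$ for all $v\in V\setminus\{r\}$, $w\in V\setminus\{v\}$;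 (P8) $0\le x_{u,v}\le 1$ for all arcs; (P9) $0\le l_{v,i},g_{i,v}\le 1$ for all $v,i$. -}

module Defs where

open import Data.Nat as ℕ using (ℕ; suc; s≤s; _⊔_)
import Data.Nat.Properties as ℕ
open import Data.Integer as ℤ using (+_)
open import Data.Rational as ℚ using (ℚ; 0ℚ; 1ℚ; ½; ∣_∣)
import Data.Rational.Properties as ℚ
open import Algebra.Bundles using (CommutativeMonoid)
open import Algebra.Properties.CommutativeSemigroup
  (CommutativeMonoid.commutativeSemigroup ℚ.+-0-commutativeMonoid) using (interchange)
open import Data.Fin using (Fin; zero; suc; inject₁; fromℕ; fromℕ<; _≟_)
open import Data.List using (List; []; _∷_; foldr; map; filter; allFin)
open import Data.List.Membership.DecPropositional using () renaming (_∈?_ to member?)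
open import Data.Product using (_×_; _,_; ∃-syntax)
open import Relation.Nullary using (¬?)
open import Relation.Binary.PropositionalEquality
  using (_≡_; _≢_; refl; sym; cong; subst; module ≡-Reasoning)

------------------------------------------------------------------------
-- Real numbers as rational Cauchy sequences, taken up to _≈_.  Only the
-- ordered additive group is developed: all constraints below are linear
-- with coefficients 0 and ±1.

Cauchy : (ℕ → ℚ) → Set
Cauchy s = ∀ ε → 0ℚ ℚ.< ε →
  ∃[ N ] (∀ m n → N ℕ.≤ m → N ℕ.≤ n → ∣ s m ℚ.- s n ∣ ℚ.≤ ε)

record ℝ : Set where
  constructor mkℝ
  field
    seq    : ℕ → ℚ
    cauchy : Cauchy seq

open ℝ public

infix 4 _≤_ _≥_ _≈_

-- The slack ε is needed: the limit of x may be at most that of y although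
-- every term of x exceeds the corresponding term of y.
_≤_ : ℝ → ℝ → Set
x ≤ y = ∀ ε → 0ℚ ℚ.< ε → ∃[ N ] (∀ n → N ℕ.≤ n → seq x n ℚ.≤ seq y n ℚ.+ ε)

_≥_ : ℝ → ℝ → Set
x ≥ y = y ≤ x

_≈_ : ℝ → ℝ → Set
x ≈ y = x ≤ y × y ≤ x

private
  half+half : ∀ p → ½ ℚ.* p ℚ.+ ½ ℚ.* p ≡ p
  half+half p = begin
    ½ ℚ.* p ℚ.+ ½ ℚ.* p ≡⟨ sym (ℚ.*-distribʳ-+ p ½ ½) ⟩
    1ℚ ℚ.* p            ≡⟨ ℚ.*-identityˡ p ⟩
    p                   ∎
    where open ≡-Reasoning

  half-pos : ∀ p → 0ℚ ℚ.< p → 0ℚ ℚ.< ½ ℚ.* p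
  half-pos p 0<p = subst (ℚ._< ½ ℚ.* p) (ℚ.*-zeroʳ ½) (ℚ.*-monoʳ-<-pos ½ 0<p)

  const-cauchy : ∀ q → Cauchy (λ _ → q)
  const-cauchy q ε 0<ε = 0 , λ _ _ _ _ →
    subst (ℚ._≤ ε) (sym (cong ∣_∣ (ℚ.+-inverseʳ q))) (ℚ.<⇒≤ 0<ε)

  +-cauchy : ∀ s t → Cauchy s → Cauchy t → Cauchy (λ n → s n ℚ.+ t n)
  +-cauchy s t cs ct ε 0<ε
    with cs (½ ℚ.* ε) (half-pos ε 0<ε) | ct (½ ℚ.* ε) (half-pos ε 0<ε)
  ... | M , hs | N , ht = M ⊔ N , λ m n p q → begin
    ∣ (s m ℚ.+ t m) ℚ.- (s n ℚ.+ t n) ∣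
      ≡⟨ cong ∣_∣ (rearrange (s m) (t m) (s n) (t n)) ⟩
    ∣ (s m ℚ.- s n) ℚ.+ (t m ℚ.- t n) ∣
      ≤⟨ ℚ.∣p+q∣≤∣p∣+∣q∣ (s m ℚ.- s n) (t m ℚ.- t n) ⟩
    ∣ s m ℚ.- s n ∣ ℚ.+ ∣ t m ℚ.- t n ∣
      ≤⟨ ℚ.+-mono-≤ (hs m n (ℕ.m⊔n≤o⇒m≤o M N p) (ℕ.m⊔n≤o⇒m≤o M N q))
                    (ht m n (ℕ.m⊔n≤o⇒n≤o M N p) (ℕ.m⊔n≤o⇒n≤o M N q)) ⟩
    ½ ℚ.* ε ℚ.+ ½ ℚ.* ε
      ≡⟨ half+half ε ⟩
    ε ∎
    where
    open ℚ.≤-Reasoning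
    rearrange : ∀ a b c d → (a ℚ.+ b) ℚ.- (c ℚ.+ d) ≡ (a ℚ.- c) ℚ.+ (b ℚ.- d)
    rearrange a b c d = begin-equality
      (a ℚ.+ b) ℚ.- (c ℚ.+ d)         ≡⟨ cong ((a ℚ.+ b) ℚ.+_) (ℚ.neg-distrib-+ c d) ⟩
      (a ℚ.+ b) ℚ.+ (ℚ.- c ℚ.+ ℚ.- d) ≡⟨ interchange a b (ℚ.- c) (ℚ.- d) ⟩
      (a ℚ.- c) ℚ.+ (b ℚ.- d)         ∎

  neg-cauchy : ∀ s → Cauchy s → Cauchy (λ n → ℚ.- s n)
  neg-cauchy s cs ε 0<ε with cs ε 0<ε
  ... | N , hs = N , λ m n p q →
    subst (ℚ._≤ ε) (sym (lemma (s m) (s n))) (hs m n p q)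
    where
    open ≡-Reasoning
    lemma : ∀ a b → ∣ ℚ.- a ℚ.- ℚ.- b ∣ ≡ ∣ a ℚ.- b ∣
    lemma a b = begin
      ∣ ℚ.- a ℚ.- ℚ.- b ∣  ≡⟨ cong ∣_∣ (sym (ℚ.neg-distrib-+ a (ℚ.- b))) ⟩
      ∣ ℚ.- (a ℚ.- b) ∣    ≡⟨ ℚ.∣-p∣≡∣p∣ (a ℚ.- b) ⟩
      ∣ a ℚ.- b ∣          ∎

infixl 6 _+_ _-_
infix  8 -_

_+_ : ℝ → ℝ → ℝ
x + y = mkℝ (λ n → seq x n ℚ.+ seq y n) (+-cauchy (seq x) (seq y) (cauchy x) (cauchy y))

-_ : ℝ → ℝ
- x = mkℝ (λ n → ℚ.- seq x n) (neg-cauchy (seq x) (cauchy x))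

_-_ : ℝ → ℝ → ℝ
x - y = x + - y

fromℚ : ℚ → ℝ
fromℚ q = mkℝ (λ _ → q) (const-cauchy q)

natℝ : ℕ → ℝ
natℝ n = fromℚ (+ n ℚ./ 1)

0ℝ 1ℝ : ℝ
0ℝ = fromℚ 0ℚ
1ℝ = fromℚ 1ℚ

∑ : {A : Set} → List A → (A → ℝ) → ℝ
∑ as f = foldr _+_ 0ℝ (map f as)

syntax ∑ as (λ a → e) = ∑[ a ← as ] e

------------------------------------------------------------------------
-- The node set V is Fin n; V∖ S lists each node outside S exactly once.

V∖_ : ∀ {n} → List (Fin n) → List (Fin n)
V∖ S = filter (λ u → ¬? (member? _≟_ u S)) (allFin _)

-- x is indexed by all pairs for convenience; there is no arc (u , u), and
-- the diagonal values occur in no constraint.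
record PartialOrderingPolytope
    (n : ℕ) (r : Fin n) (H : ℕ) (1≤H : 1 ℕ.≤ H)
    (x : Fin n → Fin n → ℝ)
    (l : Fin n → Fin (suc H) → ℝ)
    (g : Fin (suc H) → Fin n → ℝ) : Set where
  field
    root-l     : l r zero ≈ 0ℝ
    root-g     : g zero r ≈ 0ℝ
    nonroot-l  : ∀ v → v ≢ r → l v (fromℕ< {1} (s≤s 1≤H)) ≈ 0ℝ
    nonroot-g  : ∀ v → v ≢ r → g (fromℕ H) v ≈ 0ℝ
    l-mono     : ∀ v (i : Fin H) → l v (inject₁ i) - l v (suc i) ≤ 0ℝ
    g-l-compl  : ∀ v (i : Fin H) → g (inject₁ i) v + l v (suc i) ≈ 1ℝ
    arc-order  : ∀ u v → v ≢ u → ∀ i → l u i + g i v ≥ x u v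
    in-degree  : ∀ v → ∑[ u ← V∖ (v ∷ []) ] x u v ≤ 1ℝ
    connected  : ∀ v w → v ≢ r → w ≢ v → ∑[ u ← V∖ (v ∷ w ∷ []) ] x u v ≥ x v w
    x-bounds   : ∀ u v → u ≢ v → 0ℝ ≤ x u v × x u v ≤ 1ℝ
    l-bounds   : ∀ v i → 0ℝ ≤ l v i × l v i ≤ 1ℝ
    g-bounds   : ∀ v i → 0ℝ ≤ g i v × g i v ≤ 1ℝ

{-# OPTIONS --safe #-}
-- Let p i be the value g_{i,v_i} if v_i ≠ r and 0 otherwise.  Every arc of the
-- walk satisfies x_{v_i,v_{i+1}} + p i ≤ 1 + p (i+1): away from r this is (P5)
-- rewritten by (P4), out of r it is x ≤ 1, and no weight enters r because
-- x_{u,r} ≤ l_{u,0} + g_{0,r} ≤ 0.  Telescoping from p = 1 at the start (P2, P4)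
-- to p = 0 at the end (P2) gives the bound.  The plain g would not do, since
-- g_{H,r} is not forced to vanish.
module Submission where

open import Defs
open import Data.Nat using (ℕ; zero; suc; s≤s; z≤n; _⊔_) renaming (_≤_ to _≤ℕ_)
import Data.Nat.Properties as ℕ
open import Data.Integer as ℤ using (+_)
import Data.Integer.Properties as ℤ
open import Data.Rational as ℚ using (0ℚ; 1ℚ; ½)
import Data.Rational.Properties as ℚ
open import Data.Rational.Solver using (module +-*-Solver)
open import Data.Rational.Unnormalised as ℚᵘ using (mkℚᵘ; 1ℚᵘ; *≡*)
import Data.Rational.Unnormalised.Properties as ℚᵘ
open import Data.Fin using (Fin; zero; suc; inject₁; fromℕ; _≟_)
open import Data.List using (allFin; tabulate)
open import Data.Product using (_×_; _,_; proj₁; proj₂; ∃-syntax)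
open import Function using (id; _∘_)
open import Relation.Nullary using (yes; no; contradiction)
open import Relation.Binary.PropositionalEquality
  using (_≡_; _≢_; refl; sym; trans; cong; subst)
open +-*-Solver using (solve; _:+_; _:-_; _:*_; _:=_; con)

halve : ∀ ε → 0ℚ ℚ.< ε → ∃[ δ ] 0ℚ ℚ.< δ × δ ℚ.+ δ ≡ ε
halve ε 0<ε = ½ ℚ.* ε
  , subst (ℚ._< ½ ℚ.* ε) (ℚ.*-zeroʳ ½) (ℚ.*-monoʳ-<-pos ½ 0<ε)
  , solve 1 (λ e → con ½ :* e :+ con ½ :* e := e) refl ε

-- `ℚ./` reduces by a gcd, which is stuck on a variable `m`; for unnormalised fractions only
-- cross-multiplication remains. The ring solver sees `+ m ℚ./ 1` as an atom, so `telescope` needs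
-- this equation separately.
natℚ-suc : ∀ m → + suc m ℚ./ 1 ≡ 1ℚ ℚ.+ (+ m ℚ./ 1)
natℚ-suc m = ℚ.toℚᵘ-injective (begin-equality
  ℚ.toℚᵘ (+ suc m ℚ./ 1)
    ≃⟨ ℚ.toℚᵘ-fromℚᵘ (mkℚᵘ (+ suc m) 0) ⟩
  mkℚᵘ (+ suc m) 0
    ≃⟨ *≡* (cong (λ k → (+ 1 ℤ.+ k) ℤ.* + 1) (sym (ℤ.*-identityʳ (+ m)))) ⟩
  1ℚᵘ ℚᵘ.+ mkℚᵘ (+ m) 0
    ≃⟨ ℚᵘ.+-congʳ 1ℚᵘ (ℚ.toℚᵘ-fromℚᵘ (mkℚᵘ (+ m) 0)) ⟨
  ℚ.toℚᵘ 1ℚ ℚᵘ.+ ℚ.toℚᵘ (+ m ℚ./ 1)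
    ≃⟨ ℚ.toℚᵘ-homo-+ 1ℚ (+ m ℚ./ 1) ⟨
  ℚ.toℚᵘ (1ℚ ℚ.+ (+ m ℚ./ 1)) ∎)
  where open ℚᵘ.≤-Reasoning

≤-refl : ∀ x → x ≤ x
≤-refl x ε 0<ε = 0 , λ n _ →
  subst (ℚ._≤ seq x n ℚ.+ ε) (ℚ.+-identityʳ (seq x n)) (ℚ.+-monoʳ-≤ (seq x n) (ℚ.<⇒≤ 0<ε))

-- All linear arithmetic on ℝ goes through this lemma; its last argument is a
-- ring identity in ℚ.
≤-by-sum : ∀ x y a b c d → a ≤ b → c ≤ d →
  (∀ n → seq x n ℚ.- seq y n ≡ (seq a n ℚ.- seq b n) ℚ.+ (seq c n ℚ.- seq d n)) → x ≤ y
≤-by-sum x y a b c d a≤b c≤d x-y≡ ε 0<ε with halve ε 0<ε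
-- Matching `refl` turns `ε` into `δ + δ`, one `δ` for each of the two hypotheses.
... | δ , 0<δ , refl with a≤b δ 0<δ | c≤d δ 0<δ
... | M , ha | N , hc = M ⊔ N , λ n p → begin
  seq x n
    ≡⟨ solve 2 (λ x y → x := (x :- y) :+ y) refl (seq x n) (seq y n) ⟩
  (seq x n ℚ.- seq y n) ℚ.+ seq y n
    ≡⟨ cong (ℚ._+ seq y n) (x-y≡ n) ⟩
  ((seq a n ℚ.- seq b n) ℚ.+ (seq c n ℚ.- seq d n)) ℚ.+ seq y n
    ≤⟨ ℚ.+-monoˡ-≤ (seq y n) (ℚ.+-mono-≤
         (ℚ.+-monoˡ-≤ (ℚ.- seq b n) (ha n (ℕ.m⊔n≤o⇒m≤o M N p)))
         (ℚ.+-monoˡ-≤ (ℚ.- seq d n) (hc n (ℕ.m⊔n≤o⇒n≤o M N p)))) ⟩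
  (((seq b n ℚ.+ δ) ℚ.- seq b n) ℚ.+ ((seq d n ℚ.+ δ) ℚ.- seq d n)) ℚ.+ seq y n
    ≡⟨ solve 4 (λ b d e y → (((b :+ e) :- b) :+ ((d :+ e) :- d)) :+ y := y :+ (e :+ e))
         refl (seq b n) (seq d n) δ (seq y n) ⟩
  seq y n ℚ.+ (δ ℚ.+ δ) ∎
  where open ℚ.≤-Reasoning

≤-trans : ∀ x y z → x ≤ y → y ≤ z → x ≤ z
≤-trans x y z x≤y y≤z = ≤-by-sum x z x y y z x≤y y≤z λ n →
  solve 3 (λ x y z → x :- z := (x :- y) :+ (y :- z)) refl (seq x n) (seq y n) (seq z n)

-- Induction on `m`: `p (suc zero)` cancels between the first step and the bound for the rest. A
-- general `a` is needed because the tail of `allFin` is a `tabulate suc`, not an `allFin`.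
telescope : ∀ {A : Set} m (a : Fin m → A) (f : A → ℝ) (p : Fin (suc m) → ℝ) →
  (∀ i → f (a i) + p (inject₁ i) ≤ 1ℝ + p (suc i)) → p (fromℕ m) ≤ 0ℝ →
  ∑ (tabulate a) f + p zero ≤ natℝ m
telescope zero a f p step end =
  ≤-by-sum (0ℝ + p zero) 0ℝ (p zero) 0ℝ 0ℝ 0ℝ end (≤-refl 0ℝ) λ n →
    solve 1 (λ p → (con 0ℚ :+ p) :- con 0ℚ := (p :- con 0ℚ) :+ (con 0ℚ :- con 0ℚ))
      refl (seq (p zero) n)
telescope (suc m) a f p step end =
  ≤-by-sum (total + p zero) (natℝ (suc m))
    (f (a zero) + p zero) (1ℝ + p (suc zero)) (rest + p (suc zero)) (natℝ m)
    (step zero) (telescope m (a ∘ suc) f (p ∘ suc) (step ∘ suc) end)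
    λ n → trans
      (cong (λ k → seq (total + p zero) n ℚ.- k) (natℚ-suc m))
      (solve 5 (λ c s p₀ p₁ k → ((c :+ s) :+ p₀) :- (con 1ℚ :+ k)
                             := ((c :+ p₀) :- (con 1ℚ :+ p₁)) :+ ((s :+ p₁) :- k))
        refl (seq (f (a zero)) n) (seq rest n) (seq (p zero) n)
             (seq (p (suc zero)) n) (+ m ℚ./ 1))
  where
  total rest : ℝ
  total = ∑ (tabulate a) f
  rest  = ∑ (tabulate (a ∘ suc)) f

module _ {n : ℕ} {r : Fin n} {H : ℕ}
  {x : Fin n → Fin n → ℝ}
  {l : Fin n → Fin (suc (suc H)) → ℝ} {g : Fin (suc (suc H)) → Fin n → ℝ}
  (P : PartialOrderingPolytope n r (suc H) (s≤s z≤n) x l g) where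

  open PartialOrderingPolytope P

  -- (P2) fixes `l` off the root at index 1 only; monotonicity (P3) carries the bound down to index
  -- 0.
  l₀≤0 : ∀ u → u ≢ r → l u zero ≤ 0ℝ
  l₀≤0 u u≢r =
    ≤-by-sum (l u zero) 0ℝ (l u zero - l u (suc zero)) 0ℝ (l u (suc zero)) 0ℝ
      (l-mono u zero) (proj₁ (nonroot-l u u≢r)) λ n →
      solve 2 (λ l₀ l₁ → l₀ :- con 0ℚ := ((l₀ :- l₁) :- con 0ℚ) :+ (l₁ :- con 0ℚ))
        refl (seq (l u zero) n) (seq (l u (suc zero)) n)

  no-arc-into-root : ∀ u → u ≢ r → x u r ≤ 0ℝ
  no-arc-into-root u u≢r =
    ≤-trans (x u r) (l u zero + g zero r) 0ℝ (arc-order u r (u≢r ∘ sym) zero)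
      (≤-by-sum (l u zero + g zero r) 0ℝ (l u zero) 0ℝ (g zero r) 0ℝ
        (l₀≤0 u u≢r) (proj₁ root-g) λ n →
        solve 2 (λ l g → (l :+ g) :- con 0ℚ := (l :- con 0ℚ) :+ (g :- con 0ℚ))
          refl (seq (l u zero) n) (seq (g zero r) n))

  potential : Fin (suc (suc H)) → Fin n → ℝ
  potential i u with u ≟ r
  ... | yes _ = 0ℝ
  ... | no  _ = g i u

  potential-step : ∀ u v i → u ≢ v →
    x u v + potential (inject₁ i) u ≤ 1ℝ + potential (suc i) v
  potential-step u v i u≢v with u ≟ r | v ≟ r
  ... | yes refl | yes refl = contradiction refl u≢v
  ... | yes refl | no  _    =
    ≤-by-sum (x u v + 0ℝ) (1ℝ + g (suc i) v) (x u v) 1ℝ 0ℝ (g (suc i) v)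
      (proj₂ (x-bounds u v u≢v)) (proj₁ (g-bounds v (suc i))) λ n →
      solve 2 (λ c h → (c :+ con 0ℚ) :- (con 1ℚ :+ h) := (c :- con 1ℚ) :+ (con 0ℚ :- h))
        refl (seq (x u v) n) (seq (g (suc i) v) n)
  -- The potential may drop by as much as 1 on reaching the root, which `g ≤ 1` and the weight being
  -- at most 0 pay for.
  ... | no  u≢r  | yes refl =
    ≤-by-sum (x u v + g (inject₁ i) u) (1ℝ + 0ℝ) (x u v) 0ℝ (g (inject₁ i) u) 1ℝ
      (no-arc-into-root u u≢r) (proj₂ (g-bounds u (inject₁ i))) λ n →
      solve 2 (λ c g → (c :+ g) :- (con 1ℚ :+ con 0ℚ) := (c :- con 0ℚ) :+ (g :- con 1ℚ))
        refl (seq (x u v) n) (seq (g (inject₁ i) u) n)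
  -- (P5) is taken at `suc i` and (P4) at `i`, so that both contain `l u (suc i)`, which cancels.
  ... | no  _    | no  _    =
    ≤-by-sum (x u v + g (inject₁ i) u) (1ℝ + g (suc i) v)
      (x u v) (l u (suc i) + g (suc i) v) (g (inject₁ i) u + l u (suc i)) 1ℝ
      (arc-order u v (u≢v ∘ sym) (suc i)) (proj₁ (g-l-compl u i)) λ n →
      solve 4 (λ c g l h → (c :+ g) :- (con 1ℚ :+ h)
                        := (c :- (l :+ h)) :+ ((g :+ l) :- con 1ℚ))
        refl (seq (x u v) n) (seq (g (inject₁ i) u) n)
             (seq (l u (suc i)) n) (seq (g (suc i) v) n)

  potential-start : ∀ u → u ≢ r → 1ℝ ≤ potential zero u
  potential-start u u≢r with u ≟ r
  ... | yes u≡r = contradiction u≡r u≢r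
  ... | no  _   =
    ≤-by-sum 1ℝ (g zero u) 1ℝ (g zero u + l u (suc zero)) (l u (suc zero)) 0ℝ
      (proj₂ (g-l-compl u zero)) (proj₁ (nonroot-l u u≢r)) λ n →
      solve 2 (λ g l → con 1ℚ :- g := (con 1ℚ :- (g :+ l)) :+ (l :- con 0ℚ))
        refl (seq (g zero u) n) (seq (l u (suc zero)) n)

  potential-end : ∀ u → potential (fromℕ (suc H)) u ≤ 0ℝ
  potential-end u with u ≟ r
  ... | yes _   = ≤-refl 0ℝ
  ... | no  u≢r = proj₁ (nonroot-g u u≢r)

theorem1 : (n : ℕ) (r : Fin n) (H : ℕ) (1≤H : 1 ≤ℕ H)
    (x : Fin n → Fin n → ℝ) (l : Fin n → Fin (suc H) → ℝ) (g : Fin (suc H) → Fin n → ℝ) →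
    PartialOrderingPolytope n r H 1≤H x l g →
    (v : Fin (suc H) → Fin n) →
    ((i : Fin H) → v (inject₁ i) ≢ v (suc i)) →
    v zero ≢ r →
    ∑[ i ← allFin H ] x (v (inject₁ i)) (v (suc i)) ≤ natℝ H - 1ℝ
-- With the hop limit in the form `suc H`, the index 1 in `nonroot-l` computes to `suc zero`.
theorem1 n r (suc H) (s≤s z≤n) x l g P v arc v₀≢r =
  ≤-by-sum total (natℝ (suc H) - 1ℝ) (total + p zero) (natℝ (suc H)) 1ℝ (p zero)
    (telescope (suc H) id weight p
      (λ i → potential-step P (v (inject₁ i)) (v (suc i)) i (arc i))
      (potential-end P (v (fromℕ (suc H)))))
    (potential-start P (v zero) v₀≢r) λ n →
    solve 3 (λ s k p → s :- (k :- con 1ℚ) := ((s :+ p) :- k) :+ (con 1ℚ :- p))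
      refl (seq total n) (+ suc H ℚ./ 1) (seq (p zero) n)
  where
  weight : Fin (suc H) → ℝ
  weight i = x (v (inject₁ i)) (v (suc i))
  total : ℝ
  total = ∑ (allFin (suc H)) weight
  p : Fin (suc (suc H)) → ℝ
  p i = potential P i (v i)
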